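{- Let $N=((V\cup \{s\}, A),\tau)$ be an acyclic temporal network (no arc enters $s$) and let $k\in \mathbb{N}$ be such that $$\min\{k,|\rho_N^i(v)|\}\ge \min\{k,|\delta_N^i(v)|\} \quad \text{for all } i\in \mathbb{N} \text{ and all } v\in V.$$ Then there exist $k$ pairwise arc-disjoint $\tau$-respecting $s$-arborescences $T_1,\dots,T_k$ in $D=(V\cup\{s\},A)$ such that each vertex $v\in V$ belongs to exactly $\min\{k,d^-_A(v)\}$ of them.
   Context: A temporal network is a pair $N=(D,\tau)$ where $D=(V\cup\{s\},A)$ is a directed graph (parallel arcs allowed) with a root $s$ that no arc enters, and $\tau:A\to\mathbb{N}$. $N$ is acyclic if $D$ has no directed cycle. $d^-_A(v)$ is the number of arcs entering $v$. For $i\in\mathbb{N}$, $\rho_N^i(v)=\{a \text{ entering } v:\tau(a)\le i\}$ and $\delta_N^i(v)=\{a\text{ leaving } v:\tau(a)\le i\}$. An $s$-arborescence is an acyclic subgraph $F=(V'\cup\{s\},A')$ with $V'\subseteq V$ in which every vertex of $V'$ has in-degree exactly $1$ (it need not span $V$). A directed path with arcs $a_1,\dots,a_\ell$ in order is $\tau$-respecting if $\tau(a_1)\le\tau(a_2)\le\dots\le\tau(a_\ell)$; an $s$-arborescence is $\tau$-respecting if for each of its vertices $v$ the unique $(s,v)$-path in it is $\tau$-respecting. -}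

module Defs where

open import Data.Fin using (Fin)
import Data.Fin as Fin
open import Data.Fin.Subset using (Subset; _∈_; _∩_; ∣_∣; ⊤; Empty)
open import Data.Fin.Subset.Properties using (_∈?_)
open import Data.List using (List; []; _∷_; map)
open import Data.List.Relation.Unary.Linked using (Linked)
open import Data.List.Relation.Unary.Unique.Propositional using (Unique)
open import Data.Maybe using (Maybe; just; nothing)
open import Data.Maybe.Properties using (≡-dec)
open import Data.Maybe.Relation.Unary.All using (All)
open import Data.Nat using (ℕ; _≤_; _≤?_)
open import Data.Product using (_×_; ∃-syntax)
open import Data.Vec using (tabulate)
open import Level using (Level)
open import Relation.Binary.PropositionalEquality using (_≡_; _≢_)
open import Relation.Nullary using (¬_; does)
open import Relation.Nullary.Decidable using (_×-dec_)
open import Relation.Unary using (Pred; Decidable)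

private variable
  ℓ : Level
  n : ℕ

comprehension : {P : Pred (Fin n) ℓ} → Decidable P → Subset n
comprehension P? = tabulate (λ x → does (P? x))

-- V is Fin ∣V∣ and V ∪ {s} is Maybe V, with s = nothing.  Arcs are named
-- (Fin ∣A∣), so parallel arcs are allowed; heads lie in V because no arc
-- enters s.
record TemporalNetwork : Set where
  field
    ∣V∣ ∣A∣ : ℕ

  V : Set
  V = Fin ∣V∣

  Arc : Set
  Arc = Fin ∣A∣

  Vertex : Set
  Vertex = Maybe V

  s : Vertex
  s = nothing

  field
    tail : Arc → Vertex
    head : Arc → V
    τ    : Arc → ℕ

  entering : V → Subset ∣A∣
  entering v = comprehension (λ a → head a Fin.≟ v)

  d⁻ : V → ℕ
  d⁻ v = ∣ entering v ∣

  ρ : ℕ → V → Subset ∣A∣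
  ρ i v = comprehension (λ a → (head a Fin.≟ v) ×-dec (τ a ≤? i))

  δ : ℕ → V → Subset ∣A∣
  δ i v = comprehension (λ a → (≡-dec Fin._≟_ (tail a) (just v)) ×-dec (τ a ≤? i))

  -- Walk B u w as: as is, in order, the arc sequence of a directed walk
  -- from u to w using only arcs of B.
  data Walk (B : Subset ∣A∣) : Vertex → Vertex → List Arc → Set where
    []   : ∀ {u} → Walk B u u []
    step : ∀ {u w a as} → a ∈ B → tail a ≡ u →
           Walk B (just (head a)) w as → Walk B u w (a ∷ as)

  IsPath : Subset ∣A∣ → Vertex → Vertex → List Arc → Set
  IsPath B u w as = Walk B u w as × Unique (u ∷ map (λ a → just (head a)) as)

  -- In a closed walk every vertex occurs as a head, the base point included,
  -- so distinct heads means distinct vertices.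
  IsCycle : Subset ∣A∣ → List Arc → Set
  IsCycle B as = as ≢ [] × (∃[ u ] Walk B u u as) × Unique (map head as)

  AcyclicArcs : Subset ∣A∣ → Set
  AcyclicArcs B = ∀ as → ¬ IsCycle B as

  Acyclic : Set
  Acyclic = AcyclicArcs ⊤

  PathRespecting : List Arc → Set
  PathRespecting as = Linked _≤_ (map τ as)

  -- The subgraph (V′ ∪ {s}, A′).
  record Subgraph : Set where
    field
      V′ : Subset ∣V∣
      A′ : Subset ∣A∣

    -- Membership in V′ ∪ {s}: All holds trivially at nothing = s.
    HasVertex : Vertex → Set
    HasVertex = All (_∈ V′)

    field
      tail-closed : ∀ {a} → a ∈ A′ → HasVertex (tail a)
      head-closed : ∀ {a} → a ∈ A′ → head a ∈ V′

  open Subgraph public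

  record IsArborescence (F : Subgraph) : Set where
    field
      acyclic   : AcyclicArcs (A′ F)
      in-degree : ∀ {v} → v ∈ V′ F → ∣ A′ F ∩ entering v ∣ ≡ 1

  Respecting : Subgraph → Set
  Respecting F = ∀ v → HasVertex F v →
    ∃[ p ] IsPath (A′ F) s v p
         × (∀ q → IsPath (A′ F) s v q → q ≡ p)
         × PathRespecting p

  ArcDisjoint : Subgraph → Subgraph → Set
  ArcDisjoint F G = Empty (A′ F ∩ A′ G)

  multiplicity : ∀ {k} → (Fin k → Subgraph) → V → ℕ
  multiplicity T v = ∣ comprehension (λ j → v ∈? V′ (T j)) ∣

{-# OPTIONS --safe #-}

-- Colour the arcs with k colours (or leave them uncoloured), treating the
-- vertices in reverse topological order: when v is treated, the arcs leaving v
-- have their final colours.  Give each colour j the deadline min τ(f) over the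
-- arcs f of colour j leaving v.  Sort the colours by deadline and the arcs
-- entering v by τ, and give the i-th arc the i-th colour.  At most
-- min{k, |δⁱ(v)|} ≤ |ρⁱ(v)| colours have a deadline ≤ i, so every colour with a
-- deadline is given to an arc no later than that deadline.  The colour classes
-- are then the required arborescences.
module Submission where

open import Data.Fin using (Fin; zero; suc)
import Data.Fin as Fin
open import Data.Fin.Induction using (spo-wellFounded; spo-noetherian)
open import Data.Fin.Properties using (suc-injective)
open import Data.Fin.Subset using (Subset; inside; outside; ⊤; _∩_; ∣_∣) renaming (_∈_ to _∈ₛ_)
open import Data.Fin.Subset.Properties using (∈⊤; x∈p∩q⁺; x∈p∩q⁻; _∈?_)
open import Data.List using (List; []; _∷_; _∷ʳ_; _++_; map; length; filter; zip; take; allFin; initLast; _∷ʳ′_)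
open import Data.List.Extrema.Nat using (min; max; min≤xs; xs≤max; argmin-sel)
open import Data.List.Membership.Propositional using (_∈_; _∉_)
open import Data.List.Membership.Propositional.Properties using (∈-map⁺; ∈-map⁻; ∈-filter⁺; ∈-filter⁻; ∈-allFin; ∈-∃++)
import Data.List.Membership.DecPropositional as DecMembership
open import Data.List.Properties using (length-map; length-filter; length-tabulate; length-zipWith; filter-accept; filter-none; take-map; map-∘)
open import Data.List.Relation.Binary.Permutation.Propositional using (_↭_; ↭-sym; ↭⇒↭ₛ)
open import Data.List.Relation.Binary.Permutation.Propositional.Properties using (↭-length; ∈-resp-↭; shift)
import Data.List.Relation.Binary.Permutation.Setoid.Properties as Permutationₛ
open import Data.List.Relation.Unary.All as All using (All; []; _∷_)
open import Data.List.Relation.Unary.All.Properties using (¬Any⇒All¬)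
open import Data.List.Relation.Unary.AllPairs using (AllPairs; []; _∷_)
open import Data.List.Relation.Unary.Any using (here; there)
open import Data.List.Relation.Unary.Linked using ([]; [-]; _∷_)
open import Data.List.Relation.Unary.Linked.Properties using (Linked⇒AllPairs)
open import Data.List.Relation.Unary.Unique.Propositional using (Unique)
import Data.List.Relation.Unary.Unique.Propositional.Properties as Unique
open import Data.List.Reverse using (Reverse; reverseView; []; _∶_∶ʳ_)
import Data.List.Sort as Sort
open import Data.Maybe using (Maybe; just; nothing)
open import Data.Maybe.Properties using (≡-dec; just-injective)
import Data.Maybe.Relation.Unary.All as Maybe
open import Data.Nat using (ℕ; suc; _≤_; _<_; _≥_; _⊓_; _≤?_; z≤n; s≤s; s≤s⁻¹)
open import Data.Nat.Properties
  using (≤-refl; ≤-trans; ≤-antisym; ≤-reflexive; <-≤-trans; <⇒≱; ⊓-comm; ⊓-glb; m⊓n≤n; ≤-decTotalOrder; module ≤-Reasoning)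
open import Data.Product using (_×_; _,_; proj₁; proj₂; Σ-syntax; ∃-syntax; -,_)
open import Data.Sum using (inj₁; inj₂)
open import Data.Vec as Vec using (Vec; lookup; tabulate)
open import Data.Vec.Properties using (lookup∘tabulate; tabulate-cong; []=⇒lookup; lookup⇒[]=)
open import Function using (_∘_; id; flip; _on_)
open import Induction.WellFounded as WF using (WellFounded; Acc; acc)
open import Level using (Level; 0ℓ)
open import Relation.Binary using (DecidableEquality; IsStrictPartialOrder)
import Relation.Binary.Construct.On as On
open import Relation.Binary.PropositionalEquality
  using (_≡_; _≢_; refl; sym; trans; cong; cong₂; subst; isEquivalence; setoid; resp₂)
open import Relation.Nullary using (yes; no; contradiction)
open import Relation.Nullary.Decidable using (dec-true; decidable-stable; _×-dec_)
open import Relation.Unary using (Pred; Decidable)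
open import Defs

private variable
  ℓ : Level
  A B : Set
  n : ℕ

-- Lists and finite subsets

-- Pigeonhole by induction: the head of `xs` is cut out of `ys`, and since it does not recur in
-- `xs`, the rest of `xs` still lies in what is left of `ys`.
Unique∧⊆⇒length≤ : {xs ys : List A} → Unique xs → (∀ {x} → x ∈ xs → x ∈ ys) → length xs ≤ length ys
Unique∧⊆⇒length≤ [] _ = z≤n
Unique∧⊆⇒length≤ {xs = x ∷ xs} {ys} (x∉xs ∷ xs!) xs⊆ys with ∈-∃++ (xs⊆ys (here refl))
... | as , bs , refl = begin
  suc (length xs)         ≤⟨ s≤s (Unique∧⊆⇒length≤ xs! xs⊆as++bs) ⟩
  suc (length (as ++ bs)) ≡⟨ ↭-length (shift x as bs) ⟨
  length (as ++ x ∷ bs)   ∎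
  where
  open ≤-Reasoning
  xs⊆as++bs : ∀ {y} → y ∈ xs → y ∈ as ++ bs
  xs⊆as++bs y∈xs with ∈-resp-↭ (shift x as bs) (xs⊆ys (there y∈xs))
  ... | here refl = contradiction refl (All.lookup x∉xs y∈xs)
  ... | there y∈  = y∈

-- A repetition-free listing, through which cardinalities of subsets are compared by the pigeonhole
-- argument on lists.
elements : Subset n → List (Fin n)
elements Vec.[]            = []
elements (inside  Vec.∷ p) = zero ∷ map suc (elements p)
elements (outside Vec.∷ p) = map suc (elements p)

length-elements : (p : Subset n) → length (elements p) ≡ ∣ p ∣
length-elements Vec.[]            = refl
length-elements (inside  Vec.∷ p) = cong suc (trans (length-map suc (elements p)) (length-elements p))
length-elements (outside Vec.∷ p) = trans (length-map suc (elements p)) (length-elements p)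

zero∉map-suc : {xs : List (Fin n)} → zero ∉ map suc xs
zero∉map-suc 0∈ with ∈-map⁻ suc 0∈
... | _ , _ , ()

elements-unique : (p : Subset n) → Unique (elements p)
elements-unique Vec.[]            = []
elements-unique (inside  Vec.∷ p) = ¬Any⇒All¬ _ zero∉map-suc ∷ Unique.map⁺ suc-injective (elements-unique p)
elements-unique (outside Vec.∷ p) = Unique.map⁺ suc-injective (elements-unique p)

∈-elements⁺ : {p : Subset n} {x : Fin n} → x ∈ₛ p → x ∈ elements p
∈-elements⁺ {p = inside  Vec.∷ p} Vec.here       = here refl
∈-elements⁺ {p = inside  Vec.∷ p} (Vec.there x∈) = there (∈-map⁺ suc (∈-elements⁺ x∈))
∈-elements⁺ {p = outside Vec.∷ p} (Vec.there x∈) = ∈-map⁺ suc (∈-elements⁺ x∈)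

∈-elements⁻ : {p : Subset n} {x : Fin n} → x ∈ elements p → x ∈ₛ p
∈-elements⁻ {p = inside  Vec.∷ p} (here refl) = Vec.here
∈-elements⁻ {p = inside  Vec.∷ p} (there x∈) with ∈-map⁻ suc x∈
... | _ , y∈ , refl = Vec.there (∈-elements⁻ y∈)
∈-elements⁻ {p = outside Vec.∷ p} x∈ with ∈-map⁻ suc x∈
... | _ , y∈ , refl = Vec.there (∈-elements⁻ y∈)

∣p∣≤length : {p : Subset n} {xs : List (Fin n)} → (∀ {x} → x ∈ₛ p → x ∈ xs) → ∣ p ∣ ≤ length xs
∣p∣≤length {p = p} p⊆xs rewrite sym (length-elements p) =
  Unique∧⊆⇒length≤ (elements-unique p) (p⊆xs ∘ ∈-elements⁻)

length≤∣p∣ : {p : Subset n} {xs : List (Fin n)} → Unique xs → (∀ {x} → x ∈ xs → x ∈ₛ p) → length xs ≤ ∣ p ∣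
length≤∣p∣ {p = p} xs! xs⊆p rewrite sym (length-elements p) =
  Unique∧⊆⇒length≤ xs! (∈-elements⁺ ∘ xs⊆p)

module _ {P : Pred (Fin n) ℓ} (P? : Decidable P) where

  ∈-comprehension⁺ : ∀ {x} → P x → x ∈ₛ comprehension P?
  ∈-comprehension⁺ {x} px = lookup⇒[]= x _ (trans (lookup∘tabulate _ x) (dec-true (P? x) px))

  ∈-comprehension⁻ : ∀ {x} → x ∈ₛ comprehension P? → P x
  ∈-comprehension⁻ {x} x∈ with P? x | trans (sym (lookup∘tabulate _ x)) ([]=⇒lookup x∈)
  ... | yes px | _ = px

Unique-resp-↭ : {xs ys : List A} → xs ↭ ys → Unique xs → Unique ys
Unique-resp-↭ xs↭ys = Permutationₛ.Unique-resp-↭ (setoid _) (↭⇒↭ₛ xs↭ys)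

module _ (f : A → ℕ) where

  open Sort (On.decTotalOrder ≤-decTotalOrder f) public
    using () renaming (sort to sortBy; sort-↭ to sortBy-↭; sort-↗ to sortBy-↗)

  sortBy-monotone : ∀ xs → AllPairs (_≤_ on f) (sortBy xs)
  sortBy-monotone xs = Linked⇒AllPairs ≤-trans (sortBy-↗ xs)

-- Association lists

module _ (_≟_ : DecidableEquality A) where

  find : List (A × B) → A → Maybe B
  find []             x = nothing
  find ((y , b) ∷ ps) x with x ≟ y
  ... | yes _ = just b
  ... | no  _ = find ps x

  find-sound : ∀ (ps : List (A × B)) {x b} → find ps x ≡ just b → (x , b) ∈ ps
  find-sound ((y , b) ∷ ps) {x} eq with x ≟ y
  find-sound ((y , b) ∷ ps) {x} refl | yes refl = here refl
  ... | no _ = there (find-sound ps eq)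

  -- Since the keys are distinct, no earlier pair can shadow `(x , b)`.
  find-complete : ∀ {ps : List (A × B)} {x b} → Unique (map proj₁ ps) → (x , b) ∈ ps → find ps x ≡ just b
  find-complete {ps = (y , _) ∷ ps} {x} (y∉ ∷ ps!) x∈ with x ≟ y | x∈
  ... | yes _    | here refl = refl
  ... | yes refl | there x∈′ = contradiction refl (All.lookup y∉ (∈-map⁺ proj₁ x∈′))
  ... | no x≢y   | here refl = contradiction refl x≢y
  ... | no _     | there x∈′ = find-complete ps! x∈′

∈-zip⁻ : ∀ (xs : List A) (ys : List B) {x y} → (x , y) ∈ zip xs ys → x ∈ xs × y ∈ ys
∈-zip⁻ (x ∷ xs) (y ∷ ys) (here refl) = here refl , here refl
∈-zip⁻ (x ∷ xs) (y ∷ ys) (there p∈) with ∈-zip⁻ xs ys p∈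
... | x∈ , y∈ = there x∈ , there y∈

zip-unique₁ : ∀ {xs : List A} (ys : List B) → Unique xs → Unique (map proj₁ (zip xs ys))
zip-unique₁ ys       []          = []
zip-unique₁ []       (_ ∷ _)     = []
zip-unique₁ {xs = x ∷ xs} (y ∷ ys) (x∉ ∷ xs!) = All.tabulate fresh ∷ zip-unique₁ ys xs!
  where
  fresh : ∀ {z} → z ∈ map proj₁ (zip xs ys) → x ≢ z
  fresh z∈ with ∈-map⁻ proj₁ z∈
  ... | _ , p∈ , refl = All.lookup x∉ (proj₁ (∈-zip⁻ xs ys p∈))

zip-unique₂ : ∀ (xs : List A) {ys : List B} → Unique ys → Unique (map proj₂ (zip xs ys))
zip-unique₂ []       _   = []
zip-unique₂ (_ ∷ _)  []  = []
zip-unique₂ (x ∷ xs) {y ∷ ys} (y∉ ∷ ys!) = All.tabulate fresh ∷ zip-unique₂ xs ys!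
  where
  fresh : ∀ {z} → z ∈ map proj₂ (zip xs ys) → y ≢ z
  fresh z∈ with ∈-map⁻ proj₂ z∈
  ... | _ , p∈ , refl = All.lookup y∉ (proj₂ (∈-zip⁻ xs ys p∈))

unique₂⇒injective : ∀ {ps : List (A × B)} {x y b} → Unique (map proj₂ ps) → (x , b) ∈ ps → (y , b) ∈ ps → x ≡ y
unique₂⇒injective _        (here refl) (here refl) = refl
unique₂⇒injective (b∉ ∷ _) (here refl) (there y∈)  = contradiction refl (All.lookup b∉ (∈-map⁺ proj₂ y∈))
unique₂⇒injective (b∉ ∷ _) (there x∈)  (here refl) = contradiction refl (All.lookup b∉ (∈-map⁺ proj₂ x∈))
unique₂⇒injective (_ ∷ p!) (there x∈)  (there y∈)  = unique₂⇒injective p! x∈ y∈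

-- Matching jobs with deadlines

module _ (f : A → ℕ) (g : B → ℕ) where

  private
    f≤? : ∀ i → Decidable (λ x → f x ≤ i)
    f≤? i x = f x ≤? i

    g≤? : ∀ i → Decidable (λ y → g y ≤ i)
    g≤? i y = g y ≤? i

  -- A value of g that is at least M stands for "no deadline".
  HallBelow : ℕ → List A → List B → Set
  HallBelow M xs ys = ∀ {i} → i < M → length (filter (g≤? i) ys) ≤ length (filter (f≤? i) xs)

  -- At the threshold `g y` the job `y` itself is counted, so some slot must be counted too; as `x`
  -- is the earliest slot, it is among them.
  hall⇒head≤ : ∀ {M x xs y ys} → AllPairs (_≤_ on f) (x ∷ xs) → HallBelow M (x ∷ xs) (y ∷ ys) →
               g y < M → f x ≤ g y
  hall⇒head≤ {M} {x} {xs} {y} {ys} (x≤xs ∷ _) hall gy<M = decidable-stable (f x ≤? g y) λ fx≰gy →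
    contradiction
      (begin
        1                                      ≤⟨ s≤s z≤n ⟩
        suc (length (filter (g≤? (g y)) ys))   ≡⟨ cong length (filter-accept (g≤? (g y)) ≤-refl) ⟨
        length (filter (g≤? (g y)) (y ∷ ys))   ≤⟨ hall gy<M ⟩
        length (filter (f≤? (g y)) (x ∷ xs))   ≡⟨ cong length (filter-none (f≤? (g y))
                                                    (fx≰gy ∷ All.map (λ fx≤fz fz≤gy → fx≰gy (≤-trans fx≤fz fz≤gy)) x≤xs)) ⟩
        0                                      ∎)
      λ ()
    where open ≤-Reasoning

  -- If `g y` exceeds `i`, sortedness leaves nothing to count in `ys`. Otherwise both `x` and `y`
  -- are counted at `i`, and removing them lowers each side by one.
  hall-tail : ∀ {M x xs y ys} → AllPairs (_≤_ on f) (x ∷ xs) → AllPairs (_≤_ on g) (y ∷ ys) →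
              HallBelow M (x ∷ xs) (y ∷ ys) → HallBelow M xs ys
  hall-tail {M} {x} {xs} {y} {ys} xs↗ (y≤ys ∷ _) hall {i} i<M with g y ≤? i
  ... | no gy≰i = ≤-trans
    (≤-reflexive (cong length (filter-none (g≤? i) (All.map (λ gy≤gz gz≤i → gy≰i (≤-trans gy≤gz gz≤i)) y≤ys))))
    z≤n
  ... | yes gy≤i = s≤s⁻¹ (begin
    suc (length (filter (g≤? i) ys))   ≡⟨ cong length (filter-accept (g≤? i) gy≤i) ⟨
    length (filter (g≤? i) (y ∷ ys))   ≤⟨ hall i<M ⟩
    length (filter (f≤? i) (x ∷ xs))   ≡⟨ cong length (filter-accept (f≤? i) fx≤i) ⟩
    suc (length (filter (f≤? i) xs))   ∎)
    where
    open ≤-Reasoning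
    fx≤i : f x ≤ i
    fx≤i = ≤-trans (hall⇒head≤ xs↗ hall (<-≤-trans (s≤s gy≤i) i<M)) gy≤i

  -- Earliest deadline first: Hall's condition settles the first pair and passes to the tails, so
  -- pairing two sorted lists in order meets every genuine deadline.
  zip-meets-deadlines : ∀ {M xs ys} → AllPairs (_≤_ on f) xs → AllPairs (_≤_ on g) ys → HallBelow M xs ys →
                        ∀ {y} → y ∈ ys → g y < M → ∃[ x ] (x , y) ∈ zip xs ys × f x ≤ g y
  -- With no slot left, `y` counted at its own deadline already violates Hall's condition.
  zip-meets-deadlines {xs = []} {ys} _ _ hall {y} y∈ gy<M
    with filter (g≤? (g y)) ys | ∈-filter⁺ (g≤? (g y)) y∈ ≤-refl | hall gy<M
  ... | _ ∷ _ | _ | ()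
  zip-meets-deadlines {xs = x ∷ _} {_ ∷ _} xs↗ _ hall (here refl) gy<M =
    x , here refl , hall⇒head≤ xs↗ hall gy<M
  zip-meets-deadlines {xs = _ ∷ _} {_ ∷ _} xs↗@(_ ∷ xs↗′) ys↗@(_ ∷ ys↗′) hall (there y∈) gy<M
    with zip-meets-deadlines xs↗′ ys↗′ (hall-tail xs↗ ys↗ hall) y∈ gy<M
  ... | x , p∈ , fx≤gy = x , there p∈ , fx≤gy

module _ (N : TemporalNetwork) where

  open TemporalNetwork N

  -- Walks in acyclic networks

  private variable
    C D : Subset ∣A∣
    u v w : Vertex
    a : Arc
    as bs : List Arc

  Walk-mono : (∀ {a} → a ∈ₛ C → a ∈ₛ D) → Walk C u v as → Walk D u v as
  Walk-mono C⊆D []                = []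
  Walk-mono C⊆D (step a∈ t≡ walk) = step (C⊆D a∈) t≡ (Walk-mono C⊆D walk)

  Walk-++ : Walk C u v as → Walk C v w bs → Walk C u w (as ++ bs)
  Walk-++ []                walk′ = walk′
  Walk-++ (step a∈ t≡ walk) walk′ = step a∈ t≡ (Walk-++ walk walk′)

  Walk-unsnoc : ∀ as → Walk C u w (as ∷ʳ a) → Walk C u (tail a) as × a ∈ₛ C × w ≡ just (head a)
  Walk-unsnoc []       (step a∈ refl [])   = [] , a∈ , refl
  Walk-unsnoc (_ ∷ as) (step b∈ t≡ walk) with Walk-unsnoc as walk
  ... | walk′ , a∈ , w≡ = step b∈ t≡ walk′ , a∈ , w≡

  -- The prefix ends at the given occurrence of `x` and so has at least one arc. Writing it with
  -- `take` lets distinctness of heads be inherited from the whole walk.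
  Walk-take : ∀ {x} → Walk C u w as → x ∈ map head as →
              ∃[ m ] take (suc m) as ≢ [] × Walk C u (just x) (take (suc m) as)
  Walk-take (step a∈ t≡ walk) (here refl) = 0 , (λ ()) , step a∈ t≡ []
  Walk-take (step a∈ t≡ walk) (there x∈) with Walk-take walk x∈
  ... | m , _ , walk′ = suc m , (λ ()) , step a∈ t≡ walk′

  -- If `head a` recurred later, the prefix of the remaining walk up to the recurrence would be
  -- closed, with distinct heads by induction: a cycle.
  heads-unique : AcyclicArcs C → Walk C u w as → Unique (map head as)
  heads-unique acyclic [] = []
  heads-unique acyclic (step {a = a} {as} a∈ t≡ walk) = ¬Any⇒All¬ _ head∉ ∷ heads!
    where
    heads! : Unique (map head as)
    heads! = heads-unique acyclic walk
    head∉ : head a ∉ map head as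
    head∉ head∈ with Walk-take walk head∈
    ... | m , ≢[] , cycle =
      acyclic _ (≢[] , (_ , cycle) , subst Unique (take-map (suc m) as) (Unique.take⁺ (suc m) heads!))

  walk⇒path : AcyclicArcs C → Walk C s w as → IsPath C s w as
  walk⇒path {as = as} acyclic walk = walk , s∉ as ∷ map-just! (heads-unique acyclic walk)
    where
    s∉ : ∀ bs → All (s ≢_) (map (just ∘ head) bs)
    s∉ []       = []
    s∉ (_ ∷ bs) = (λ ()) ∷ s∉ bs
    map-just! : ∀ {bs} → Unique (map head bs) → Unique (map (just ∘ head) bs)
    map-just! {bs} heads! = subst Unique (sym (map-∘ bs)) (Unique.map⁺ just-injective heads!)

  -- The walks are compared from their last arcs backwards: the end vertex determines the last arc,
  -- and a nonempty walk cannot end at `s` because every head lies in `V`.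
  walks-from-s-unique : (∀ {a b} → a ∈ₛ C → b ∈ₛ C → head a ≡ head b → a ≡ b) →
                        Walk C s w as → Walk C s w bs → as ≡ bs
  walks-from-s-unique {C = C} {as = as} {bs = bs} injective = go (reverseView as) bs
    where
    go : ∀ {w as} → Reverse as → ∀ bs → Walk C s w as → Walk C s w bs → as ≡ bs
    go [] bs [] walk′ with initLast bs
    ... | [] = refl
    ... | bs ∷ʳ′ b with Walk-unsnoc bs walk′
    ... | _ , _ , ()
    go (as ∶ rs ∶ʳ a) bs walk walk′ with Walk-unsnoc as walk | initLast bs
    go (as ∶ rs ∶ʳ a) _ _ [] | _ , _ , () | []
    go (as ∶ rs ∶ʳ a) _ _ walk′ | walk₁ , a∈ , refl | bs ∷ʳ′ b with Walk-unsnoc bs walk′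
    ... | walk₂ , b∈ , eq with injective a∈ b∈ (just-injective eq)
    ... | refl = cong (_∷ʳ a) (go rs bs walk₁ walk₂)

  -- Reachability by a nonempty walk. In a finite acyclic network it is a strict order, well-founded
  -- in both directions: one is used to trace trees back to `s`, the other to construct the
  -- colouring.
  _⊏_ : V → V → Set
  x ⊏ y = ∃[ a ] ∃[ as ] Walk ⊤ (just x) (just y) (a ∷ as)

  arc⇒⊏ : ∀ {x} → tail a ≡ just x → x ⊏ head a
  arc⇒⊏ t≡ = -, -, step ∈⊤ t≡ []

  ⊏-isStrictPartialOrder : Acyclic → IsStrictPartialOrder _≡_ _⊏_
  ⊏-isStrictPartialOrder acyclic = record
    { isEquivalence = isEquivalence
    -- A nonempty closed walk has distinct heads by `heads-unique`, so it would itself be a cycle.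
    ; irrefl        = λ { refl (_ , _ , cycle) → acyclic _ ((λ ()) , (_ , cycle) , heads-unique acyclic cycle) }
    ; trans         = λ { (_ , _ , step a∈ t≡ walk) (_ , _ , walk′) → -, -, step a∈ t≡ (Walk-++ walk walk′) }
    ; <-resp-≈      = resp₂ _⊏_
    }

  -- From a colouring to arborescences

  _≟ᶜ_ : ∀ {k} → DecidableEquality (Maybe (Fin k))
  _≟ᶜ_ = ≡-dec Fin._≟_

  -- The interface between the two halves of the proof. `proper` bounds in-degrees by one in each
  -- colour; `supported` makes each colour class connected to `s` and forces times to increase
  -- weakly; `colours v` lists the trees that will contain `v`.
  record Colouring (k : ℕ) : Set where
    field
      colour    : Arc → Maybe (Fin k)
      proper    : ∀ {a b j} → head a ≡ head b → colour a ≡ just j → colour b ≡ just j → a ≡ b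
      supported : ∀ {a j v} → colour a ≡ just j → tail a ≡ just v →
                  ∃[ e ] head e ≡ v × colour e ≡ just j × τ e ≤ τ a

      colours          : V → List (Fin k)
      colours-unique   : ∀ v → Unique (colours v)
      length-colours   : ∀ v → length (colours v) ≡ k ⊓ d⁻ v
      colours-sound    : ∀ {v j} → j ∈ colours v → ∃[ a ] head a ≡ v × colour a ≡ just j
      colours-complete : ∀ {a j} → colour a ≡ just j → j ∈ colours (head a)

  module FromColouring (acyclic : Acyclic) {k : ℕ} (χ : Colouring k) where

    open Colouring χ
    open DecMembership (Fin._≟_ {k}) using () renaming (_∈?_ to _∈ₗ?_)

    class : Fin k → Subset ∣A∣
    class j = comprehension (λ a → colour a ≟ᶜ just j)

    covered : Fin k → Subset ∣V∣
    covered j = comprehension (λ v → j ∈ₗ? colours v)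

    ∈-class⁻ : ∀ {j a} → a ∈ₛ class j → colour a ≡ just j
    ∈-class⁻ {j} = ∈-comprehension⁻ (λ a → colour a ≟ᶜ just j)

    ∈-class⁺ : ∀ {j a} → colour a ≡ just j → a ∈ₛ class j
    ∈-class⁺ {j} = ∈-comprehension⁺ (λ a → colour a ≟ᶜ just j)

    ∈-covered⁻ : ∀ {j v} → v ∈ₛ covered j → j ∈ colours v
    ∈-covered⁻ {j} = ∈-comprehension⁻ (λ v → j ∈ₗ? colours v)

    ∈-covered⁺ : ∀ {j v} → j ∈ colours v → v ∈ₛ covered j
    ∈-covered⁺ {j} = ∈-comprehension⁺ (λ v → j ∈ₗ? colours v)

    head∈covered : ∀ {j a} → colour a ≡ just j → head a ∈ₛ covered j
    head∈covered = ∈-covered⁺ ∘ colours-complete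

    tree : Fin k → Subgraph
    tree j .V′ = covered j
    tree j .A′ = class j
    tree j .tail-closed {a} a∈ = closed (tail a) refl
      where
      closed : ∀ u → tail a ≡ u → Maybe.All (_∈ₛ covered j) u
      closed nothing  _  = Maybe.nothing
      closed (just v) t≡ with supported (∈-class⁻ a∈) t≡
      ... | e , refl , ce≡ , _ = Maybe.just (head∈covered ce≡)
    tree j .head-closed = head∈covered ∘ ∈-class⁻

    class-injective : ∀ {j a b} → a ∈ₛ class j → b ∈ₛ class j → head a ≡ head b → a ≡ b
    class-injective a∈ b∈ h≡ = proper h≡ (∈-class⁻ a∈) (∈-class⁻ b∈)

    class-acyclic : ∀ j → AcyclicArcs (class j)
    class-acyclic j as (≢[] , (u , walk) , heads!) = acyclic as (≢[] , (u , Walk-mono (λ _ → ∈⊤) walk) , heads!)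

    -- `colours-sound` supplies one arc, and `proper` excludes a second.
    class-in-degree : ∀ {j v} → v ∈ₛ covered j → ∣ class j ∩ entering v ∣ ≡ 1
    class-in-degree {j} {v} v∈ with colours-sound (∈-covered⁻ v∈)
    ... | a , refl , ca≡ = ≤-antisym (∣p∣≤length ⊆[a]) (length≤∣p∣ ([] ∷ []) [a]⊆)
      where
      enters? : Decidable (λ b → head b ≡ head a)
      enters? b = head b Fin.≟ head a
      ⊆[a] : ∀ {b} → b ∈ₛ class j ∩ entering (head a) → b ∈ a ∷ []
      ⊆[a] b∈ with x∈p∩q⁻ (class j) _ b∈
      ... | b∈class , b∈entering = here (proper (∈-comprehension⁻ enters? b∈entering) (∈-class⁻ b∈class) ca≡)
      [a]⊆ : ∀ {b} → b ∈ a ∷ [] → b ∈ₛ class j ∩ entering (head a)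
      [a]⊆ (here refl) = x∈p∩q⁺ (∈-class⁺ ca≡ , ∈-comprehension⁺ enters? refl)

    -- `supported` yields an arc of colour `j` into the tail of `b` that is no later than `b`; by
    -- `proper` that arc is `a`.
    consecutive-≤ : ∀ {j a b} → a ∈ₛ class j → b ∈ₛ class j → tail b ≡ just (head a) → τ a ≤ τ b
    consecutive-≤ a∈ b∈ t≡ with supported (∈-class⁻ b∈) t≡
    ... | e , h≡ , ce≡ , τe≤τb with proper h≡ ce≡ (∈-class⁻ a∈)
    ... | refl = τe≤τb

    walk-respecting : ∀ {j u w as} → Walk (class j) u w as → PathRespecting as
    walk-respecting []              = []
    walk-respecting (step a∈ t≡ []) = [-]
    walk-respecting (step a∈ t≡ walk@(step b∈ t≡′ _)) = consecutive-≤ a∈ b∈ t≡′ ∷ walk-respecting walk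

    -- Trace backwards: an arc of colour `j` enters `v`, and unless its tail is `s`, `supported`
    -- gives an arc of the same colour into that tail. Well-foundedness of `_⊏_` ends the descent.
    walk-to : ∀ {j} v → Acc _⊏_ v → v ∈ₛ covered j → ∃[ as ] Walk (class j) s (just v) as
    walk-to {j} v (acc rs) v∈ with colours-sound (∈-covered⁻ v∈)
    ... | a , refl , ca≡ = extend (tail a) refl
      where
      last-step : ∀ {as} → Walk (class j) s (tail a) as → ∃[ as ] Walk (class j) s (just (head a)) as
      last-step walk = -, Walk-++ walk (step (∈-class⁺ ca≡) refl [])
      extend : ∀ u → tail a ≡ u → ∃[ as ] Walk (class j) s (just (head a)) as
      extend nothing  t≡ = last-step (subst (λ u → Walk (class j) s u []) (sym t≡) [])
      extend (just u) t≡ with supported ca≡ t≡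
      ... | e , refl , ce≡ , _ with walk-to (head e) (rs (arc⇒⊏ t≡)) (head∈covered ce≡)
      ... | as , walk = last-step (subst (λ u → Walk (class j) s u as) (sym t≡) walk)

    tree-isArborescence : ∀ j → IsArborescence (tree j)
    tree-isArborescence j = record { acyclic = class-acyclic j ; in-degree = class-in-degree }

    tree-respecting : ∀ j → Respecting (tree j)
    tree-respecting j v v∈ with reach v v∈
      where
      reach : ∀ v → HasVertex (tree j) v → ∃[ as ] Walk (class j) s v as
      reach nothing  _               = [] , []
      reach (just v) (Maybe.just v∈) = walk-to v (spo-wellFounded (⊏-isStrictPartialOrder acyclic) v) v∈
    ... | as , walk =
      as , walk⇒path (class-acyclic j) walk ,
      (λ bs (walk′ , _) → walks-from-s-unique class-injective walk′ walk) ,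
      walk-respecting walk

    trees-arcDisjoint : ∀ i j → i ≢ j → ArcDisjoint (tree i) (tree j)
    trees-arcDisjoint i j i≢j (a , a∈) with x∈p∩q⁻ (class i) (class j) a∈
    ... | a∈i , a∈j = i≢j (just-injective (trans (sym (∈-class⁻ a∈i)) (∈-class⁻ a∈j)))

    tree-multiplicity : ∀ v → multiplicity tree v ≡ k ⊓ d⁻ v
    tree-multiplicity v = trans
      (≤-antisym (∣p∣≤length (∈-covered⁻ ∘ ∈-comprehension⁻ contains?))
                 (length≤∣p∣ (colours-unique v) (∈-comprehension⁺ contains? ∘ ∈-covered⁺)))
      (length-colours v)
      where
      contains? : Decidable (λ j → v ∈ₛ covered j)
      contains? j = v ∈? covered j

  -- The greedy colouring

  module Greedy (acyclic : Acyclic) (k : ℕ)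
                (ρ≥δ : ∀ (i : ℕ) (v : V) → k ⊓ ∣ ρ i v ∣ ≥ k ⊓ ∣ δ i v ∣) where

    -- Strictly later than every arc, hence usable as the default deadline of a colour absent from
    -- the arcs leaving a vertex.
    horizon : ℕ
    horizon = suc (max 0 (map τ (allFin ∣A∣)))

    τ<horizon : ∀ a → τ a < horizon
    τ<horizon a = s≤s (All.lookup (xs≤max 0 _) (∈-map⁺ τ (∈-allFin a)))

    inArcs : V → List Arc
    inArcs v = sortBy τ (elements (entering v))

    inArcs-↭ : ∀ v → inArcs v ↭ elements (entering v)
    inArcs-↭ v = sortBy-↭ τ (elements (entering v))

    inArcs-unique : ∀ v → Unique (inArcs v)
    inArcs-unique v = Unique-resp-↭ (↭-sym (inArcs-↭ v)) (elements-unique (entering v))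

    length-inArcs : ∀ v → length (inArcs v) ≡ d⁻ v
    length-inArcs v = trans (↭-length (inArcs-↭ v)) (length-elements (entering v))

    ∈-inArcs⁻ : ∀ {v a} → a ∈ inArcs v → head a ≡ v
    ∈-inArcs⁻ {v} = ∈-comprehension⁻ (λ a → head a Fin.≟ v) ∘ ∈-elements⁻ ∘ ∈-resp-↭ (inArcs-↭ v)

    ∈-inArcs⁺ : ∀ {v a} → head a ≡ v → a ∈ inArcs v
    ∈-inArcs⁺ {v} = ∈-resp-↭ (↭-sym (inArcs-↭ v)) ∘ ∈-elements⁺ ∘ ∈-comprehension⁺ (λ a → head a Fin.≟ v)

    deadline : Vec (Maybe (Fin k)) ∣A∣ → Fin k → ℕ
    deadline cs j = min horizon (map τ (filter (λ a → lookup cs a ≟ᶜ just j) (allFin ∣A∣)))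

    deadline≤τ : ∀ cs {a j} → lookup cs a ≡ just j → deadline cs j ≤ τ a
    deadline≤τ cs {a} {j} ca≡ =
      All.lookup (min≤xs horizon _) (∈-map⁺ τ (∈-filter⁺ (λ a → lookup cs a ≟ᶜ just j) (∈-allFin a) ca≡))

    -- The minimum is either the default `horizon`, ruled out by `i < horizon`, or the time of an
    -- arc of colour `j`.
    deadline-attained : ∀ cs {j i} → deadline cs j ≤ i → i < horizon → ∃[ a ] lookup cs a ≡ just j × τ a ≤ i
    deadline-attained cs {j} {i} dj≤i i<h
      with argmin-sel id horizon (map τ (filter (λ a → lookup cs a ≟ᶜ just j) (allFin ∣A∣)))
    ... | inj₁ dj≡h = contradiction (subst (_≤ i) dj≡h dj≤i) (<⇒≱ i<h)
    ... | inj₂ dj∈ with ∈-map⁻ τ dj∈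
    ... | a , a∈ , dj≡τa =
      a , proj₂ (∈-filter⁻ (λ a → lookup cs a ≟ᶜ just j) {xs = allFin ∣A∣} a∈) , subst (_≤ i) dj≡τa dj≤i

    byDeadline : Vec (Maybe (Fin k)) ∣A∣ → List (Fin k)
    byDeadline cs = sortBy (deadline cs) (allFin k)

    byDeadline-↭ : ∀ cs → byDeadline cs ↭ allFin k
    byDeadline-↭ cs = sortBy-↭ (deadline cs) (allFin k)

    -- `zip` truncates to the shorter list, so a list of all `k` colours reaches only the first
    -- min{k, d⁻} entering arcs; the others stay uncoloured.
    colourWith : List (Fin k) → Arc → Maybe (Fin k)
    colourWith js a = find Fin._≟_ (zip (inArcs (head a)) js) a

    -- In the recursion only the palettes of vertices beyond `v` are available. Testing the tail of
    -- `a` produces the proof of `v ⊏ head a` needed to consult one.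
    outColour : ∀ v → (∀ {w} → v ⊏ w → List (Fin k)) → Arc → Maybe (Fin k)
    outColour v palettes a with ≡-dec Fin._≟_ (tail a) (just v)
    ... | yes t≡ = colourWith (palettes (arc⇒⊏ t≡)) a
    ... | no  _  = nothing

    outColour-cong : ∀ v {p q : ∀ {w} → v ⊏ w → List (Fin k)} → (∀ {w} (v⊏w : v ⊏ w) → p v⊏w ≡ q v⊏w) →
                     ∀ a → outColour v p a ≡ outColour v q a
    outColour-cong v p≗q a with ≡-dec Fin._≟_ (tail a) (just v)
    ... | yes t≡ = cong (λ js → colourWith js a) (p≗q (arc⇒⊏ t≡))
    ... | no  _  = refl

    paletteStep : ∀ v → (∀ {w} → v ⊏ w → List (Fin k)) → List (Fin k)
    paletteStep v palettes = byDeadline (tabulate (outColour v palettes))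

    -- The out-colours enter a palette only through a vector, so that pointwise
    -- equal out-colours give equal palettes without function extensionality.
    paletteStep-cong : ∀ v {p q : ∀ {w} → v ⊏ w → List (Fin k)} → (∀ {w} (v⊏w : v ⊏ w) → p v⊏w ≡ q v⊏w) →
                       paletteStep v p ≡ paletteStep v q
    paletteStep-cong v p≗q = cong byDeadline (tabulate-cong (outColour-cong v p≗q))

    ⊐-wellFounded : WellFounded (flip _⊏_)
    ⊐-wellFounded = spo-noetherian (⊏-isStrictPartialOrder acyclic)

    -- Abstract, because unfolding the well-founded recursion is very slow.
    abstract
      palette : V → List (Fin k)
      palette = WF.All.wfRec ⊐-wellFounded 0ℓ (λ _ → List (Fin k)) paletteStep

      palette-fixpoint : ∀ v → palette v ≡ paletteStep v (λ {w} _ → palette w)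
      palette-fixpoint v = WF.FixPoint.unfold-wfRec ⊐-wellFounded (λ _ → List (Fin k)) paletteStep
        (λ v → paletteStep-cong v)

    colour : Arc → Maybe (Fin k)
    colour a = colourWith (palette (head a)) a

    -- The vector to which `palette-fixpoint` applies `byDeadline`; its entries agree with `colour`
    -- on the arcs leaving `v` and are `nothing` elsewhere.
    outColours : V → Vec (Maybe (Fin k)) ∣A∣
    outColours v = tabulate (outColour v (λ {w} _ → palette w))

    outColours⁺ : ∀ {v a j} → tail a ≡ just v → colour a ≡ just j → lookup (outColours v) a ≡ just j
    outColours⁺ {v} {a} t≡ ca≡ rewrite lookup∘tabulate (outColour v (λ {w} _ → palette w)) a
      with ≡-dec Fin._≟_ (tail a) (just v)
    ... | yes _  = ca≡
    ... | no  t≢ = contradiction t≡ t≢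

    outColours⁻ : ∀ {v a j} → lookup (outColours v) a ≡ just j → tail a ≡ just v × colour a ≡ just j
    outColours⁻ {v} {a} ca≡ rewrite lookup∘tabulate (outColour v (λ {w} _ → palette w)) a
      with ≡-dec Fin._≟_ (tail a) (just v)
    ... | yes t≡ = t≡ , ca≡
    outColours⁻ {v} {a} () | no _

    palette-↭ : ∀ v → palette v ↭ allFin k
    palette-↭ v rewrite palette-fixpoint v = byDeadline-↭ (outColours v)

    palette-unique : ∀ v → Unique (palette v)
    palette-unique v = Unique-resp-↭ (↭-sym (palette-↭ v)) (Unique.allFin⁺ k)

    length-palette : ∀ v → length (palette v) ≡ k
    length-palette v = trans (↭-length (palette-↭ v)) (length-tabulate id)

    outDeadline : V → Fin k → ℕ
    outDeadline v = deadline (outColours v)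

    palette-monotone : ∀ v → AllPairs (_≤_ on outDeadline v) (palette v)
    palette-monotone v rewrite palette-fixpoint v = sortBy-monotone (deadline (outColours v)) (allFin k)

    -- Each colour due by `i` is carried by an arc leaving `v` no later than `i`, and an arc carries
    -- at most one colour. The restriction to times below `horizon` keeps colours with only the
    -- default deadline out of the count.
    palette-hall : ∀ v → HallBelow τ (outDeadline v) horizon (inArcs v) (palette v)
    palette-hall v {i} i<h = begin
      -- The hypothesis compares truncated counts, so the number of due colours is bounded by `k` as
      -- well.
      length due                        ≤⟨ ⊓-glb due≤k due≤δ ⟩
      k ⊓ ∣ δ i v ∣                     ≤⟨ ρ≥δ i v ⟩
      k ⊓ ∣ ρ i v ∣                     ≤⟨ m⊓n≤n k _ ⟩
      ∣ ρ i v ∣                         ≤⟨ ∣p∣≤length ρ⊆ ⟩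
      length (filter early? (inArcs v)) ∎
      where
      open ≤-Reasoning
      early? : Decidable (λ a → τ a ≤ i)
      early? a = τ a ≤? i
      leavesEarly? : Decidable (λ a → tail a ≡ just v × τ a ≤ i)
      leavesEarly? a = ≡-dec Fin._≟_ (tail a) (just v) ×-dec (τ a ≤? i)
      entersEarly? : Decidable (λ a → head a ≡ v × τ a ≤ i)
      entersEarly? a = (head a Fin.≟ v) ×-dec (τ a ≤? i)
      due? : Decidable (λ j → outDeadline v j ≤ i)
      due? j = outDeadline v j ≤? i
      due : List (Fin k)
      due = filter due? (palette v)
      due≤k : length due ≤ k
      due≤k = ≤-trans (length-filter due? (palette v)) (≤-reflexive (length-palette v))
      -- The inclusion is stated under `just` because `colour` may leave an arc uncoloured.
      due⊆δ : ∀ {c} → c ∈ map just due → c ∈ map colour (elements (δ i v))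
      due⊆δ c∈ with ∈-map⁻ just c∈
      ... | j , j∈ , refl
        with deadline-attained (outColours v) (proj₂ (∈-filter⁻ due? {xs = palette v} j∈)) i<h
      ... | a , oa≡ , τa≤i with outColours⁻ oa≡
      ... | t≡ , ca≡ = subst (_∈ map colour (elements (δ i v))) ca≡
        (∈-map⁺ colour (∈-elements⁺ (∈-comprehension⁺ leavesEarly? (t≡ , τa≤i))))
      due≤δ : length due ≤ ∣ δ i v ∣
      due≤δ = begin
        length due                             ≡⟨ length-map just due ⟨
        length (map just due)                  ≤⟨ Unique∧⊆⇒length≤ (Unique.map⁺ just-injective (Unique.filter⁺ due? (palette-unique v))) due⊆δ ⟩
        length (map colour (elements (δ i v))) ≡⟨ length-map colour (elements (δ i v)) ⟩
        length (elements (δ i v))              ≡⟨ length-elements (δ i v) ⟩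
        ∣ δ i v ∣                              ∎
      ρ⊆ : ∀ {a} → a ∈ₛ ρ i v → a ∈ filter early? (inArcs v)
      ρ⊆ a∈ with ∈-comprehension⁻ entersEarly? a∈
      ... | h≡ , τa≤i = ∈-filter⁺ early? (∈-inArcs⁺ h≡) τa≤i

    assignment : V → List (Arc × Fin k)
    assignment v = zip (inArcs v) (palette v)

    assignment⇒colour : ∀ {v a j} → (a , j) ∈ assignment v → head a ≡ v × colour a ≡ just j
    assignment⇒colour {v} p∈ with ∈-inArcs⁻ (proj₁ (∈-zip⁻ (inArcs v) (palette v) p∈))
    ... | refl = refl , find-complete Fin._≟_ (zip-unique₁ (palette v) (inArcs-unique v)) p∈

    colour⇒assignment : ∀ {a j} → colour a ≡ just j → (a , j) ∈ assignment (head a)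
    colour⇒assignment {a} = find-sound Fin._≟_ (assignment (head a))

    assignment-unique₂ : ∀ v → Unique (map proj₂ (assignment v))
    assignment-unique₂ v = zip-unique₂ (inArcs v) (palette-unique v)

    -- The arc `a` gives `j` a deadline at `v` of at most `τ a`, hence below `horizon`. The matching
    -- assigns `j` to an entering arc no later than this deadline.
    supported : ∀ {a j v} → colour a ≡ just j → tail a ≡ just v →
                ∃[ e ] head e ≡ v × colour e ≡ just j × τ e ≤ τ a
    supported {a} {j} {v} ca≡ t≡
      with zip-meets-deadlines τ (outDeadline v) (sortBy-monotone τ (elements (entering v)))
             (palette-monotone v) (palette-hall v)
             (∈-resp-↭ (↭-sym (palette-↭ v)) (∈-allFin j)) (<-≤-trans (s≤s dj≤τa) (τ<horizon a))
      where
      dj≤τa : outDeadline v j ≤ τ a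
      dj≤τa = deadline≤τ (outColours v) (outColours⁺ t≡ ca≡)
    ... | e , p∈ , τe≤dj with assignment⇒colour p∈
    ... | h≡ , ce≡ = e , h≡ , ce≡ , ≤-trans τe≤dj (deadline≤τ (outColours v) (outColours⁺ t≡ ca≡))

    colouring : Colouring k
    colouring = record
      { colour    = colour
      -- Arcs with a common head draw their colours from one assignment, in which no colour occurs
      -- twice.
      ; proper    = λ {a} {b} {j} h≡ ca≡ cb≡ → unique₂⇒injective (assignment-unique₂ (head b))
          (subst (λ v → (a , j) ∈ assignment v) h≡ (colour⇒assignment ca≡)) (colour⇒assignment cb≡)
      ; supported = supported
      ; colours   = map proj₂ ∘ assignment
      ; colours-unique = assignment-unique₂
      ; length-colours = length-colours
      ; colours-sound = colours-sound
      ; colours-complete = ∈-map⁺ proj₂ ∘ colour⇒assignment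
      }
      where
      length-colours : ∀ v → length (map proj₂ (assignment v)) ≡ k ⊓ d⁻ v
      length-colours v = trans (length-map proj₂ (assignment v))
        (trans (length-zipWith _,_ (inArcs v) (palette v))
          (trans (cong₂ _⊓_ (length-inArcs v) (length-palette v)) (⊓-comm (d⁻ v) k)))
      colours-sound : ∀ {v j} → j ∈ map proj₂ (assignment v) → ∃[ a ] head a ≡ v × colour a ≡ just j
      colours-sound j∈ with ∈-map⁻ proj₂ j∈
      ... | (a , _) , p∈ , refl = a , assignment⇒colour p∈

theorem2 : (N : TemporalNetwork) → let open TemporalNetwork N in
    Acyclic →
    (k : ℕ) →
    (∀ (i : ℕ) (v : V) → k ⊓ ∣ ρ i v ∣ ≥ k ⊓ ∣ δ i v ∣) →
    Σ[ T ∈ (Fin k → Subgraph) ]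
    ( (∀ j → IsArborescence (T j) × Respecting (T j))
    × (∀ i j → i ≢ j → ArcDisjoint (T i) (T j))
    × (∀ v → multiplicity T v ≡ k ⊓ d⁻ v) )
theorem2 N acyclic k ρ≥δ =
  tree , (λ j → tree-isArborescence j , tree-respecting j) , trees-arcDisjoint , tree-multiplicity
  where open FromColouring N acyclic (Greedy.colouring N acyclic k ρ≥δ)
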